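{- Let $q=p^m$ where $p$ is a prime and $m\geq 1$ is an integer, let $n\geq 2$ be an integer, and let $C$ be an extended $1$-perfect code in the Hamming graph $H(n,q)$. Then one of the following holds: (1) $n=2$; (2) $p=2$, $m=1$ and $n=2^t$ for some integer $t\geq 2$; (3) $p=2$, $m\geq 1$ and $n=q+2$.
   Context: The Hamming graph $H(n,q)$ has as vertices all words of length $n$ over the alphabet $\{0,1,\dots,q-1\}$, two words being adjacent iff they differ in exactly one coordinate. A code is a subset of the vertex set. A code $C$ in a graph $G$ is $1$-perfect if the vertex set of $G$ is partitioned by the balls of radius $1$ centered at the vertices of $C$. A code $C$ in $H(n,q)$ is an extended $1$-perfect code if deleting (puncturing) any single coordinate position from all codewords yields a $1$-perfect code in $H(n-1,q)$. -}

module Defs where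

open import Data.Nat using (ℕ; zero; suc; _+_)
open import Data.Fin using (Fin)
open import Data.Vec using (Vec; []; _∷_; removeAt)
open import Data.Product using (Σ; _×_; ∃)
open import Data.Sum using (_⊎_)
open import Data.Unit using (⊤)
open import Relation.Binary.PropositionalEquality using (_≡_)
open import Relation.Nullary using (Dec; yes; no)
open import Data.Fin using (_≟_)

Word : ℕ → ℕ → Set
Word n q = Vec (Fin q) n

hamming : ∀ {n q} → Word n q → Word n q → ℕ
hamming [] [] = 0
hamming (x ∷ xs) (y ∷ ys) with x ≟ y
... | yes _ = hamming xs ys
... | no  _ = suc (hamming xs ys)

Adjacent : ∀ {n q} → Word n q → Word n q → Set
Adjacent x y = hamming x y ≡ 1

InBall1 : ∀ {n q} → Word n q → Word n q → Set
InBall1 c x = x ≡ c ⊎ Adjacent c x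

Code : ℕ → ℕ → Set₁
Code n q = Word n q → Set

Perfect1 : ∀ {n q} → Code n q → Set
Perfect1 {n} {q} C =
  (x : Word n q) →
    (Σ (Word n q) λ c → C c × InBall1 c x)
    × (∀ c c′ → C c → C c′ → InBall1 c x → InBall1 c′ x → c ≡ c′)

Puncture : ∀ {k q} → Code (suc k) q → Fin (suc k) → Code k q
Puncture {k} {q} C i y = Σ (Word (suc k) q) λ c → C c × removeAt c i ≡ y

-- Extended 1-perfect: puncturing any coordinate yields a 1-perfect code.
-- (For n = 0 there is no coordinate, so the condition is vacuous.)
Extended1Perfect : ∀ {n q} → Code n q → Set
Extended1Perfect {zero}  C = ⊤
Extended1Perfect {suc k} C = ∀ (i : Fin (suc k)) → Perfect1 (Puncture C i)

{-# OPTIONS --safe #-}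
-- Let q = p ^ m, let f be the indicator function of C, let Λ f sum f over the n lines through a
-- point, and put N = n + q − 2. Perfectness of the n punctured codes says exactly that
-- g = 1 + q (N f − Λ f) has sum zero along every line. The integer operator Π = ∏ⱼ (q − Lⱼ), with
-- Lⱼ the line sum in direction j, multiplies such functions by qⁿ and kills both 1 and Λ f, so
-- qⁿ g = q N Π f. At a point at distance 2 from C, g = 1; hence N divides qⁿ and is a power of p.
-- Sphere packing makes 1 + (n − 1)(q − 1) a power of p as well. Writing N = q P, the latter is
-- q (1 + (P − 1)(q − 1)), and 1 + (P − 1)(q − 1) = P q + 2 − P − q can be a power of p only if
-- P = 1, or p = 2 and one of P, q is 2.
module Submission where

open import Defs
open import Data.Nat using (ℕ; _+_; _^_; _≤_)
open import Data.Nat.Primality using (Prime)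
open import Data.Product using (_×_; ∃)
open import Data.Sum using (_⊎_)
open import Relation.Binary.PropositionalEquality using (_≡_)

open import Data.Nat using (zero; suc; _*_; z≤n; s≤s; nonTrivial⇒n>1)
open import Data.Nat.Coprimality using (Coprime; coprime-divisor)
open import Data.Nat.Primality using (prime⇒irreducible; prime⇒nonZero; prime⇒nonTrivial; ¬prime[0]; ¬prime[1])
import Data.Nat.Tactic.RingSolver as ℕRing
import Data.Nat.Properties as ℕ
import Data.Nat.Divisibility as ℕ
open import Data.Integer as ℤ using (ℤ; +_; 0ℤ; 1ℤ)
import Data.Integer.Properties as ℤ
import Data.Integer.Divisibility.Signed as ℤ
open import Data.Integer.Tactic.RingSolver using (solve-∀)
open import Data.Fin using (Fin; zero; suc; _≟_)
open import Data.Vec using ([]; _∷_; replicate; insertAt; removeAt; lookup)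
open import Data.Vec.Properties using (∷-injective; ∷-injectiveˡ; ∷-injectiveʳ; ≡-dec; removeAt-insertAt; insertAt-removeAt; insertAt-lookup)
open import Data.Product using (_,_; proj₁; proj₂)
open import Data.Sum using (inj₁; inj₂)
open import Algebra.Properties.Semiring.Sum ℤ.+-*-semiring using (sum; sum-cong-≗; sum-replicate-zero; ∑-distrib-+; *-distribˡ-sum; ∑-comm)
open import Data.Unit using (⊤; tt)
open import Function using (_∘_)
open import Relation.Binary.PropositionalEquality using (_≢_; refl; sym; trans; cong; cong₂; subst; module ≡-Reasoning)
open import Relation.Nullary using (Dec; yes; no; ¬_; contradiction)

private
  variable
    n q : ℕ

-- Finite sums of integers

sum-zero : (h : Fin n → ℤ) → (∀ i → h i ≡ 0ℤ) → sum h ≡ 0ℤ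
sum-zero {n} h h≡0 = trans (sum-cong-≗ h≡0) (sum-replicate-zero n)

sum-const : ∀ n (x : ℤ) → sum {n} (λ _ → x) ≡ + n ℤ.* x
sum-const zero    x = refl
sum-const (suc n) x = begin
  x ℤ.+ sum {n} (λ _ → x)  ≡⟨ cong (λ s → x ℤ.+ s) (sum-const n x) ⟩
  x ℤ.+ + n ℤ.* x          ≡⟨ ring x (+ n) ⟩
  (1ℤ ℤ.+ + n) ℤ.* x       ∎
  where
  open ≡-Reasoning
  ring : ∀ x m → x ℤ.+ m ℤ.* x ≡ (1ℤ ℤ.+ m) ℤ.* x
  ring = solve-∀

sum-single : (h : Fin n → ℤ) (i : Fin n) → h i ≡ 1ℤ → (∀ j → j ≢ i → h j ≡ 0ℤ) → sum h ≡ 1ℤ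
sum-single h zero    h≡1 h≡0 = cong₂ ℤ._+_ h≡1 (sum-zero (h ∘ suc) (λ j → h≡0 (suc j) λ ()))
sum-single h (suc i) h≡1 h≡0 = cong₂ ℤ._+_ (h≡0 zero λ ())
  (sum-single (h ∘ suc) i h≡1 (λ j j≢i → h≡0 (suc j) λ { refl → j≢i refl }))

sum-linear : (c : ℤ) (f h : Fin n → ℤ) → sum (λ i → f i ℤ.+ c ℤ.* h i) ≡ sum f ℤ.+ c ℤ.* sum h
sum-linear c f h = trans (∑-distrib-+ f (λ i → c ℤ.* h i))
  (cong (λ s → sum f ℤ.+ s) (sym (*-distribˡ-sum c h)))

-- Balls of radius one

hamming-refl : (x : Word n q) → hamming x x ≡ 0
hamming-refl []      = refl
hamming-refl (a ∷ x) with a ≟ a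
... | yes _   = hamming-refl x
... | no  a≢a = contradiction refl a≢a

hamming≡0⇒≡ : (x y : Word n q) → hamming x y ≡ 0 → x ≡ y
hamming≡0⇒≡ []      []      _ = refl
hamming≡0⇒≡ (a ∷ x) (b ∷ y) d with a ≟ b
... | yes refl = cong (a ∷_) (hamming≡0⇒≡ x y d)

adjacent⇒≢ : {c x : Word n q} → Adjacent c x → x ≢ c
adjacent⇒≢ {c = c} adj refl = contradiction (trans (sym adj) (hamming-refl c)) λ ()

ball-∷ : (a : Fin q) {c x : Word n q} → InBall1 c x → InBall1 (a ∷ c) (a ∷ x)
ball-∷ a (inj₁ refl) = inj₁ refl
ball-∷ a {c} {x} (inj₂ d) = inj₂ adjacent
  where
  adjacent : hamming (a ∷ c) (a ∷ x) ≡ 1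
  adjacent with a ≟ a
  ... | yes _   = d
  ... | no  a≢a = contradiction refl a≢a

ball-head : (a b : Fin q) (x : Word n q) → InBall1 (a ∷ x) (b ∷ x)
ball-head a b x with a ≟ b
... | yes refl = inj₁ refl
... | no  _    = inj₂ (cong suc (hamming-refl x))

ball-removeAt : (j : Fin (suc n)) (x y : Word (suc n) q) → removeAt x j ≡ removeAt y j → InBall1 x y
ball-removeAt zero    (a ∷ x)       (b ∷ y)        refl = ball-head a b x
ball-removeAt (suc j) (a ∷ x@(_ ∷ _)) (b ∷ y@(_ ∷ _)) eq with ∷-injective eq
... | refl , eq′ = ball-∷ a (ball-removeAt j x y eq′)

-- Line sums

lineSum : Fin (suc n) → (Word (suc n) q → ℤ) → Word n q → ℤ
lineSum j f y = sum (λ a → f (insertAt y j a))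

-- The sum of f over the n lines through x.
Λ : (Word n q → ℤ) → Word n q → ℤ
Λ {zero}  f []      = 0ℤ
Λ {suc n} f (a ∷ x) = sum (λ b → f (b ∷ x)) ℤ.+ Λ (λ w → f (a ∷ w)) x

Λ-sum : ∀ {m} (f : Fin m → Word n q → ℤ) (x : Word n q) →
        Λ (λ w → sum (λ i → f i w)) x ≡ sum (λ i → Λ (f i) x)
Λ-sum {m = m} f []      = sym (sum-replicate-zero m)
Λ-sum f (a ∷ x) = begin
  sum (λ b → sum (λ i → f i (b ∷ x))) ℤ.+ Λ (λ w → sum (λ i → f i (a ∷ w))) x
    ≡⟨ cong₂ ℤ._+_ (∑-comm (λ b i → f i (b ∷ x))) (Λ-sum (λ i w → f i (a ∷ w)) x) ⟩
  sum (λ i → sum (λ b → f i (b ∷ x))) ℤ.+ sum (λ i → Λ (λ w → f i (a ∷ w)) x)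
    ≡⟨ ∑-distrib-+ (λ i → sum (λ b → f i (b ∷ x))) (λ i → Λ (λ w → f i (a ∷ w)) x) ⟨
  sum (λ i → Λ (f i) (a ∷ x)) ∎
  where open ≡-Reasoning

Λ-zero : (f : Word n q → ℤ) (x : Word n q) → (∀ z → InBall1 z x → f z ≡ 0ℤ) → Λ f x ≡ 0ℤ
Λ-zero f []      f≡0 = refl
Λ-zero f (a ∷ x) f≡0 = cong₂ ℤ._+_
  (sum-zero _ (λ b → f≡0 (b ∷ x) (ball-head b a x)))
  (Λ-zero _ x (λ z z∈B → f≡0 (a ∷ z) (ball-∷ a z∈B)))

Λ-centre : (f : Word n q → ℤ) (x : Word n q) → f x ≡ 1ℤ →
           (∀ z → InBall1 z x → z ≢ x → f z ≡ 0ℤ) → Λ f x ≡ + n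
Λ-centre f []      _   _   = refl
Λ-centre f (a ∷ x) f≡1 f≡0 = cong₂ ℤ._+_
  (sum-single _ a f≡1 (λ b b≢a → f≡0 (b ∷ x) (ball-head b a x) (b≢a ∘ ∷-injectiveˡ)))
  (Λ-centre _ x f≡1 (λ z z∈B z≢x → f≡0 (a ∷ z) (ball-∷ a z∈B) (z≢x ∘ ∷-injectiveʳ)))

-- Only one line through `x` meets `c`, namely the one along the coordinate where they differ. The
-- recursion walks to that coordinate; the lines in all other directions contribute 0.
Λ-adjacent : (f : Word n q → ℤ) (c x : Word n q) → Adjacent c x → f c ≡ 1ℤ →
             (∀ z → InBall1 z x → z ≢ c → f z ≡ 0ℤ) → Λ f x ≡ 1ℤ
Λ-adjacent f []       []      () _ _
Λ-adjacent f (c₀ ∷ c) (a ∷ x) adj f≡1 f≡0 with c₀ ≟ a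
... | yes refl = cong₂ ℤ._+_
  (sum-zero _ (λ b → f≡0 (b ∷ x) (ball-head b a x) (adjacent⇒≢ adj ∘ ∷-injectiveʳ)))
  (Λ-adjacent _ c x adj f≡1 (λ z z∈B z≢c → f≡0 (a ∷ z) (ball-∷ a z∈B) (z≢c ∘ ∷-injectiveʳ)))
... | no c₀≢a with hamming≡0⇒≡ c x (ℕ.suc-injective adj)
...   | refl = cong₂ ℤ._+_
  (sum-single _ c₀ f≡1 (λ b b≢c₀ → f≡0 (b ∷ x) (ball-head b a x) (b≢c₀ ∘ ∷-injectiveˡ)))
  (Λ-zero _ x (λ z z∈B → f≡0 (a ∷ z) (ball-∷ a z∈B) (c₀≢a ∘ sym ∘ ∷-injectiveˡ)))

-- All `q` points of a line in direction `j` share that line, which is therefore counted `q` times.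
-- In any other direction the two summations commute, which leaves a line sum of `lineSum j f`.
lineSum-Λ : (j : Fin (suc n)) (f : Word (suc n) q → ℤ) (y : Word n q) →
            lineSum j (Λ f) y ≡ + q ℤ.* lineSum j f y ℤ.+ Λ (lineSum j f) y
lineSum-Λ {q = q} zero f y = begin
  sum (λ a → sum (λ b → f (b ∷ y)) ℤ.+ Λ (λ w → f (a ∷ w)) y)
    ≡⟨ ∑-distrib-+ (λ _ → sum (λ b → f (b ∷ y))) (λ a → Λ (λ w → f (a ∷ w)) y) ⟩
  sum {q} (λ _ → sum (λ b → f (b ∷ y))) ℤ.+ sum (λ a → Λ (λ w → f (a ∷ w)) y)
    ≡⟨ cong₂ ℤ._+_ (sum-const q _) (sym (Λ-sum (λ a w → f (a ∷ w)) y)) ⟩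
  + q ℤ.* sum (λ b → f (b ∷ y)) ℤ.+ Λ (lineSum zero f) y ∎
  where open ≡-Reasoning
lineSum-Λ {q = q} (suc j) f (c ∷ y) = begin
  sum (λ a → sum (λ b → f (b ∷ insertAt y j a)) ℤ.+ Λ f′ (insertAt y j a))
    ≡⟨ ∑-distrib-+ (λ a → sum (λ b → f (b ∷ insertAt y j a))) _ ⟩
  sum (λ a → sum (λ b → f (b ∷ insertAt y j a))) ℤ.+ lineSum j (Λ f′) y
    ≡⟨ cong₂ ℤ._+_ (∑-comm (λ a b → f (b ∷ insertAt y j a))) (lineSum-Λ j f′ y) ⟩
  S ℤ.+ (+ q ℤ.* lineSum j f′ y ℤ.+ Λ (lineSum j f′) y)
    ≡⟨ ring S (+ q ℤ.* lineSum j f′ y) (Λ (lineSum j f′) y) ⟩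
  + q ℤ.* lineSum j f′ y ℤ.+ (S ℤ.+ Λ (lineSum j f′) y) ∎
  where
  open ≡-Reasoning
  f′ = λ w → f (c ∷ w)
  S  = sum (λ b → lineSum (suc j) f (b ∷ y))
  ring : ∀ s t u → s ℤ.+ (t ℤ.+ u) ≡ t ℤ.+ (s ℤ.+ u)
  ring = solve-∀

-- Π = ∏ⱼ (q − Lⱼ), where Lⱼ sums along the lines of direction j; it is qⁿ times the orthogonal
-- projection onto the functions all of whose line sums vanish.
Π : (Word n q → ℤ) → Word n q → ℤ
Π {zero}          f []      = f []
Π {suc n} {q = q} f (a ∷ x) = + q ℤ.* Π (λ w → f (a ∷ w)) x ℤ.- sum (λ b → Π (λ w → f (b ∷ w)) x)

Π-cong : {f h : Word n q → ℤ} → (∀ x → f x ≡ h x) → ∀ x → Π f x ≡ Π h x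
Π-cong         eq []      = eq []
Π-cong {q = q} eq (a ∷ x) = cong₂ ℤ._-_
  (cong (+ q ℤ.*_) (Π-cong (λ w → eq (a ∷ w)) x))
  (sum-cong-≗ (λ b → Π-cong (λ w → eq (b ∷ w)) x))

Π-linear : (c : ℤ) (f h : Word n q → ℤ) (x : Word n q) →
           Π (λ w → f w ℤ.+ c ℤ.* h w) x ≡ Π f x ℤ.+ c ℤ.* Π h x
Π-linear         c f h []      = refl
Π-linear {q = q} c f h (a ∷ x) = begin
  + q ℤ.* Π (λ w → f (a ∷ w) ℤ.+ c ℤ.* h (a ∷ w)) x ℤ.- sum (λ b → Π (λ w → f (b ∷ w) ℤ.+ c ℤ.* h (b ∷ w)) x)
    ≡⟨ cong₂ (λ s t → + q ℤ.* s ℤ.- t) (step a) (trans (sum-cong-≗ step) (sum-linear c (F f) (F h))) ⟩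
  + q ℤ.* (F f a ℤ.+ c ℤ.* F h a) ℤ.- (sum (F f) ℤ.+ c ℤ.* sum (F h))
    ≡⟨ ring (+ q) c (F f a) (F h a) (sum (F f)) (sum (F h)) ⟩
  (+ q ℤ.* F f a ℤ.- sum (F f)) ℤ.+ c ℤ.* (+ q ℤ.* F h a ℤ.- sum (F h)) ∎
  where
  open ≡-Reasoning
  F : (Word _ q → ℤ) → Fin q → ℤ
  F k b = Π (λ w → k (b ∷ w)) x
  step : ∀ b → Π (λ w → f (b ∷ w) ℤ.+ c ℤ.* h (b ∷ w)) x ≡ F f b ℤ.+ c ℤ.* F h b
  step b = Π-linear c (λ w → f (b ∷ w)) (λ w → h (b ∷ w)) x
  ring : ∀ q c s t u v → q ℤ.* (s ℤ.+ c ℤ.* t) ℤ.- (u ℤ.+ c ℤ.* v)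
                       ≡ (q ℤ.* s ℤ.- u) ℤ.+ c ℤ.* (q ℤ.* t ℤ.- v)
  ring = solve-∀

-- The factor `q − L₀` kills whatever does not vary with the head. Constancy is asked only after the
-- tail factors have acted, which is what the induction in `Π-Λ` delivers.
Π-head-independent : (f : Word (suc n) q → ℤ) (s : ℤ) (a : Fin q) (x : Word n q) →
                     (∀ b → Π (λ w → f (b ∷ w)) x ≡ s) → Π f (a ∷ x) ≡ 0ℤ
Π-head-independent {q = q} f s a x eq = begin
  + q ℤ.* Π (λ w → f (a ∷ w)) x ℤ.- sum (λ b → Π (λ w → f (b ∷ w)) x)
    ≡⟨ cong₂ (λ u v → + q ℤ.* u ℤ.- v) (eq a) (trans (sum-cong-≗ eq) (sum-const q s)) ⟩
  + q ℤ.* s ℤ.- + q ℤ.* s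
    ≡⟨ ℤ.+-inverseʳ (+ q ℤ.* s) ⟩
  0ℤ ∎
  where open ≡-Reasoning

-- `Λ f` is the sum of the `Lⱼ f`, and each `Lⱼ f` is constant in direction `j`, hence killed by
-- `q − Lⱼ`. In the recursion the tail directions vanish by induction, and the head line sum `S` is
-- the same for every head.
Π-Λ : (f : Word n q → ℤ) (x : Word n q) → Π (Λ f) x ≡ 0ℤ
Π-Λ         f []      = refl
Π-Λ {q = q} f (a ∷ x) = Π-head-independent (Λ f) (Π S x) a x λ b → begin
  Π (λ w → S w ℤ.+ Λ (λ v → f (b ∷ v)) w) x
    ≡⟨ Π-cong (λ w → cong (λ t → S w ℤ.+ t) (sym (ℤ.*-identityˡ _))) x ⟩
  Π (λ w → S w ℤ.+ 1ℤ ℤ.* Λ (λ v → f (b ∷ v)) w) x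
    ≡⟨ Π-linear 1ℤ S (Λ (λ v → f (b ∷ v))) x ⟩
  Π S x ℤ.+ 1ℤ ℤ.* Π (Λ (λ v → f (b ∷ v))) x
    ≡⟨ cong (λ t → Π S x ℤ.+ 1ℤ ℤ.* t) (Π-Λ (λ v → f (b ∷ v)) x) ⟩
  Π S x ℤ.+ 0ℤ
    ≡⟨ ℤ.+-identityʳ _ ⟩
  Π S x ∎
  where
  open ≡-Reasoning
  S = lineSum zero f

Balanced : (Word n q → ℤ) → Set
Balanced {zero}  f = ⊤
Balanced {suc n} f = ∀ j y → lineSum j f y ≡ 0ℤ

Balanced-∷ : (f : Word (suc n) q → ℤ) → Balanced f → ∀ b → Balanced (λ w → f (b ∷ w))
Balanced-∷ {zero}  f ls≡0 b     = tt
Balanced-∷ {suc n} f ls≡0 b j y = ls≡0 (suc j) (b ∷ y)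

-- Each factor `q − Lⱼ` acts on a balanced function as multiplication by `q`. Slices at a fixed head
-- stay balanced, so induction covers the tail factors.
Π-fixed : (f : Word n q → ℤ) → Balanced f → ∀ x → Π f x ≡ + (q ^ n) ℤ.* f x
Π-fixed f _ []      = sym (ℤ.*-identityˡ (f []))
Π-fixed {n = suc n} {q = q} f ls≡0 (a ∷ x) = begin
  + q ℤ.* Π (λ w → f (a ∷ w)) x ℤ.- sum (λ b → Π (λ w → f (b ∷ w)) x)
    ≡⟨ cong₂ (λ s t → + q ℤ.* s ℤ.- t) (step a)
         (trans (sum-cong-≗ step) (sym (*-distribˡ-sum (+ (q ^ n)) (λ b → f (b ∷ x))))) ⟩
  + q ℤ.* (+ (q ^ n) ℤ.* f (a ∷ x)) ℤ.- + (q ^ n) ℤ.* lineSum zero f x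
    ≡⟨ cong (λ t → + q ℤ.* (+ (q ^ n) ℤ.* f (a ∷ x)) ℤ.- + (q ^ n) ℤ.* t) (ls≡0 zero x) ⟩
  + q ℤ.* (+ (q ^ n) ℤ.* f (a ∷ x)) ℤ.- + (q ^ n) ℤ.* 0ℤ
    ≡⟨ ring (+ q) (+ (q ^ n)) (f (a ∷ x)) ⟩
  (+ q ℤ.* + (q ^ n)) ℤ.* f (a ∷ x)
    ≡⟨ cong (ℤ._* f (a ∷ x)) (ℤ.pos-* q (q ^ n)) ⟨
  + (q ^ suc n) ℤ.* f (a ∷ x) ∎
  where
  open ≡-Reasoning
  step : ∀ b → Π (λ w → f (b ∷ w)) x ≡ + (q ^ n) ℤ.* f (b ∷ x)
  step b = Π-fixed (λ w → f (b ∷ w)) (Balanced-∷ f ls≡0 b) x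
  ring : ∀ q p s → q ℤ.* (p ℤ.* s) ℤ.- p ℤ.* 0ℤ ≡ (q ℤ.* p) ℤ.* s
  ring = solve-∀

-- Sums over all words

W : (Word n q → ℤ) → ℤ
W {zero}  f = f []
W {suc n} f = sum (λ b → W (λ w → f (b ∷ w)))

W-cong : {f h : Word n q → ℤ} → (∀ x → f x ≡ h x) → W f ≡ W h
W-cong {zero}  eq = eq []
W-cong {suc n} eq = sum-cong-≗ (λ b → W-cong (λ w → eq (b ∷ w)))

W-linear : (c : ℤ) (f h : Word n q → ℤ) → W (λ w → f w ℤ.+ c ℤ.* h w) ≡ W f ℤ.+ c ℤ.* W h
W-linear {zero}  c f h = refl
W-linear {suc n} c f h = trans (sum-cong-≗ (λ b → W-linear c (λ w → f (b ∷ w)) (λ w → h (b ∷ w))))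
  (sum-linear c (λ b → W (λ w → f (b ∷ w))) (λ b → W (λ w → h (b ∷ w))))

W-sum : ∀ {m} (f : Fin m → Word n q → ℤ) → W (λ w → sum (λ i → f i w)) ≡ sum (λ i → W (f i))
W-sum {zero}  f = refl
W-sum {suc n} f = trans (sum-cong-≗ (λ b → W-sum (λ i w → f i (b ∷ w))))
  (∑-comm (λ b i → W (λ w → f i (b ∷ w))))

W-one : ∀ n q → W {n} {q} (λ _ → 1ℤ) ≡ + (q ^ n)
W-one zero    q = refl
W-one (suc n) q = begin
  sum {q} (λ _ → W {n} {q} (λ _ → 1ℤ))  ≡⟨ sum-const q _ ⟩
  + q ℤ.* W {n} {q} (λ _ → 1ℤ)          ≡⟨ cong (+ q ℤ.*_) (W-one n q) ⟩
  + q ℤ.* + (q ^ n)                     ≡⟨ ℤ.pos-* q (q ^ n) ⟨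
  + (q ^ suc n)                         ∎
  where open ≡-Reasoning

-- Double counting: a value `f z` occurs once for every line through `z` and every point of that
-- line.
W-Λ : (f : Word n q → ℤ) → W (Λ f) ≡ + n ℤ.* + q ℤ.* W f
W-Λ {zero}          f = refl
W-Λ {suc n} {q = q} f = begin
  sum (λ b → W (λ w → S w ℤ.+ Λ (f′ b) w))
    ≡⟨ sum-cong-≗ step ⟩
  sum (λ b → W S ℤ.+ + n ℤ.* + q ℤ.* W (f′ b))
    ≡⟨ sum-linear (+ n ℤ.* + q) (λ _ → W S) (λ b → W (f′ b)) ⟩
  sum {q} (λ _ → W S) ℤ.+ + n ℤ.* + q ℤ.* W f
    ≡⟨ cong (λ t → t ℤ.+ + n ℤ.* + q ℤ.* W f) (trans (sum-const q (W S)) (cong (+ q ℤ.*_) (W-sum f′))) ⟩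
  + q ℤ.* W f ℤ.+ + n ℤ.* + q ℤ.* W f
    ≡⟨ ring (+ n) (+ q) (W f) ⟩
  (1ℤ ℤ.+ + n) ℤ.* + q ℤ.* W f ∎
  where
  open ≡-Reasoning
  f′ : Fin q → Word n q → ℤ
  f′ b w = f (b ∷ w)
  S = lineSum zero f
  step : ∀ b → W (λ w → S w ℤ.+ Λ (f′ b) w) ≡ W S ℤ.+ + n ℤ.* + q ℤ.* W (f′ b)
  step b = begin
    W (λ w → S w ℤ.+ Λ (f′ b) w)           ≡⟨ W-cong (λ w → cong (λ t → S w ℤ.+ t) (sym (ℤ.*-identityˡ _))) ⟩
    W (λ w → S w ℤ.+ 1ℤ ℤ.* Λ (f′ b) w)    ≡⟨ W-linear 1ℤ S (Λ (f′ b)) ⟩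
    W S ℤ.+ 1ℤ ℤ.* W (Λ (f′ b))            ≡⟨ cong (λ t → W S ℤ.+ t) (ℤ.*-identityˡ _) ⟩
    W S ℤ.+ W (Λ (f′ b))                   ≡⟨ cong (λ t → W S ℤ.+ t) (W-Λ (f′ b)) ⟩
    W S ℤ.+ + n ℤ.* + q ℤ.* W (f′ b)       ∎
  ring : ∀ n q s → q ℤ.* s ℤ.+ n ℤ.* q ℤ.* s ≡ (1ℤ ℤ.+ n) ℤ.* q ℤ.* s
  ring = solve-∀

-- Perfect codes

-- A relation, because membership in a code is an arbitrary type without a decision procedure.
Indicator : Code n q → (Word n q → ℤ) → Set
Indicator D F = (∀ y → D y → F y ≡ 1ℤ) × (∀ y → ¬ D y → F y ≡ 0ℤ)

-- The ball around y has ball sum Λ F y − (n − 1) F y, since y lies on all n lines through it.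
BallSumsOne : (Word n q → ℤ) → Set
BallSumsOne {n} F = ∀ y → Λ F y ≡ 1ℤ ℤ.+ (+ n ℤ.- 1ℤ) ℤ.* F y

-- A codeword `y` is alone in its ball and is counted on all `n` lines through it. Otherwise the one
-- codeword in the ball is adjacent to `y` and is counted once.
perfect⇒ballSumsOne : {D : Code n q} {F : Word n q → ℤ} → Perfect1 D → Indicator D F → BallSumsOne F
perfect⇒ballSumsOne {n} {D = D} {F} perf (F≡1 , F≡0) y with perf y
... | (c , Dc , c∈B) , unique = helper c∈B
  where
  off : ∀ z → InBall1 z y → z ≢ c → F z ≡ 0ℤ
  off z z∈B z≢c = F≡0 z (λ Dz → z≢c (unique z c Dz Dc z∈B c∈B))
  centre : ∀ m → m ≡ 1ℤ ℤ.+ (m ℤ.- 1ℤ) ℤ.* 1ℤ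
  centre = solve-∀
  helper : InBall1 c y → Λ F y ≡ 1ℤ ℤ.+ (+ n ℤ.- 1ℤ) ℤ.* F y
  helper (inj₁ refl) rewrite F≡1 c Dc = trans (Λ-centre F c (F≡1 c Dc) off) (centre (+ n))
  helper (inj₂ adj) rewrite off y (inj₁ refl) (adjacent⇒≢ adj) | ℤ.*-zeroʳ (+ n ℤ.- 1ℤ) =
    Λ-adjacent F c y adj (F≡1 c Dc) off

-- Summing the ball identity over all words gives `qⁿ = (1 + n (q − 1)) W F` with `q = suc r`.
sphere-packing : ∀ {r} (F : Word n (suc r) → ℤ) → BallSumsOne F → suc (n * r) ℕ.∣ suc r ^ n
sphere-packing {n} {r} F balls = ℤ.∣⇒∣ᵤ (ℤ.divides (W F) (begin
  + (suc r ^ n)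
    ≡⟨ ring₁ (+ (suc r ^ n)) (+ n ℤ.- 1ℤ) (W F) ⟩
  (+ (suc r ^ n) ℤ.+ (+ n ℤ.- 1ℤ) ℤ.* W F) ℤ.- (+ n ℤ.- 1ℤ) ℤ.* W F
    ≡⟨ cong (λ t → t ℤ.- (+ n ℤ.- 1ℤ) ℤ.* W F) count ⟩
  + n ℤ.* (1ℤ ℤ.+ + r) ℤ.* W F ℤ.- (+ n ℤ.- 1ℤ) ℤ.* W F
    ≡⟨ ring₂ (+ n) (+ r) (W F) ⟩
  W F ℤ.* (1ℤ ℤ.+ + n ℤ.* + r)
    ≡⟨ cong (λ t → W F ℤ.* (1ℤ ℤ.+ t)) (ℤ.pos-* n r) ⟨
  W F ℤ.* + suc (n * r) ∎))
  where
  open ≡-Reasoning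
  count : + (suc r ^ n) ℤ.+ (+ n ℤ.- 1ℤ) ℤ.* W F ≡ + n ℤ.* + suc r ℤ.* W F
  count = begin
    + (suc r ^ n) ℤ.+ (+ n ℤ.- 1ℤ) ℤ.* W F
      ≡⟨ cong (λ t → t ℤ.+ (+ n ℤ.- 1ℤ) ℤ.* W F) (W-one n (suc r)) ⟨
    W {n} {suc r} (λ _ → 1ℤ) ℤ.+ (+ n ℤ.- 1ℤ) ℤ.* W F
      ≡⟨ W-linear (+ n ℤ.- 1ℤ) (λ _ → 1ℤ) F ⟨
    W (λ w → 1ℤ ℤ.+ (+ n ℤ.- 1ℤ) ℤ.* F w)
      ≡⟨ W-cong balls ⟨
    W (Λ F)
      ≡⟨ W-Λ F ⟩
    + n ℤ.* + suc r ℤ.* W F ∎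
  ring₁ : ∀ p m s → p ≡ (p ℤ.+ m ℤ.* s) ℤ.- m ℤ.* s
  ring₁ = solve-∀
  ring₂ : ∀ n r s → n ℤ.* (1ℤ ℤ.+ r) ℤ.* s ℤ.- (n ℤ.- 1ℤ) ℤ.* s ≡ s ℤ.* (1ℤ ℤ.+ n ℤ.* r)
  ring₂ = solve-∀

-- The function g is 1 + q (N f − Λ f) with N = q + n − 1. Its line sum in direction j at y is
-- q (1 + (n − 1) F y − Λ F y) for F = lineSum j f, so it vanishes.
extended-divisibility : (f : Word (suc n) q → ℤ) → (∀ j → BallSumsOne (lineSum j f)) →
                        ∀ x → f x ≡ 0ℤ → Λ f x ≡ 0ℤ → + q ℤ.+ (+ n ℤ.- 1ℤ) ℤ.∣ + (q ^ suc n)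
extended-divisibility {n} {q} f balls (a ∷ x) f≡0 Λf≡0 = ℤ.divides (Q ℤ.* Π f (a ∷ x)) (begin
  + (q ^ suc n)                          ≡⟨ ℤ.*-identityʳ _ ⟨
  + (q ^ suc n) ℤ.* 1ℤ                   ≡⟨ cong (+ (q ^ suc n) ℤ.*_) g≡1 ⟨
  + (q ^ suc n) ℤ.* g (a ∷ x)            ≡⟨ Π-fixed g g-balanced (a ∷ x) ⟨
  Π g (a ∷ x)                            ≡⟨ Π-linear (ℤ.- Q) (λ w → 1ℤ ℤ.+ (Q ℤ.* N) ℤ.* f w) (Λ f) (a ∷ x) ⟩
  Π (λ w → 1ℤ ℤ.+ (Q ℤ.* N) ℤ.* f w) (a ∷ x) ℤ.+ (ℤ.- Q) ℤ.* Π (Λ f) (a ∷ x)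
    ≡⟨ cong₂ (λ s t → s ℤ.+ (ℤ.- Q) ℤ.* t) (Π-linear (Q ℤ.* N) (λ _ → 1ℤ) f (a ∷ x)) (Π-Λ f (a ∷ x)) ⟩
  (Π {suc n} {q} (λ _ → 1ℤ) (a ∷ x) ℤ.+ (Q ℤ.* N) ℤ.* Π f (a ∷ x)) ℤ.+ (ℤ.- Q) ℤ.* 0ℤ
    ≡⟨ cong (λ s → (s ℤ.+ (Q ℤ.* N) ℤ.* Π f (a ∷ x)) ℤ.+ (ℤ.- Q) ℤ.* 0ℤ)
            (Π-head-independent (λ _ → 1ℤ) (Π (λ _ → 1ℤ) x) a x (λ _ → refl)) ⟩
  (0ℤ ℤ.+ (Q ℤ.* N) ℤ.* Π f (a ∷ x)) ℤ.+ (ℤ.- Q) ℤ.* 0ℤ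
    ≡⟨ ring₁ Q N (Π f (a ∷ x)) ⟩
  Q ℤ.* Π f (a ∷ x) ℤ.* N ∎)
  where
  open ≡-Reasoning
  Q = + q
  N = + q ℤ.+ (+ n ℤ.- 1ℤ)
  g : Word (suc n) q → ℤ
  g w = (1ℤ ℤ.+ (Q ℤ.* N) ℤ.* f w) ℤ.+ (ℤ.- Q) ℤ.* Λ f w
  ring₁ : ∀ q m s → (0ℤ ℤ.+ (q ℤ.* m) ℤ.* s) ℤ.+ (ℤ.- q) ℤ.* 0ℤ ≡ q ℤ.* s ℤ.* m
  ring₁ = solve-∀
  ring₂ : ∀ q m s → (q ℤ.* 1ℤ ℤ.+ (q ℤ.* (q ℤ.+ m)) ℤ.* s)
                    ℤ.+ (ℤ.- q) ℤ.* (q ℤ.* s ℤ.+ (1ℤ ℤ.+ m ℤ.* s)) ≡ 0ℤ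
  ring₂ = solve-∀
  ring₃ : ∀ u v → (1ℤ ℤ.+ u ℤ.* 0ℤ) ℤ.+ v ℤ.* 0ℤ ≡ 1ℤ
  ring₃ = solve-∀
  g≡1 : g (a ∷ x) ≡ 1ℤ
  g≡1 = trans (cong₂ (λ s t → (1ℤ ℤ.+ (Q ℤ.* N) ℤ.* s) ℤ.+ (ℤ.- Q) ℤ.* t) f≡0 Λf≡0) (ring₃ (Q ℤ.* N) (ℤ.- Q))
  g-balanced : Balanced g
  g-balanced j y = begin
    lineSum j g y
      ≡⟨ sum-linear (ℤ.- Q) (λ b → 1ℤ ℤ.+ (Q ℤ.* N) ℤ.* f (insertAt y j b)) (λ b → Λ f (insertAt y j b)) ⟩
    sum (λ b → 1ℤ ℤ.+ (Q ℤ.* N) ℤ.* f (insertAt y j b)) ℤ.+ (ℤ.- Q) ℤ.* lineSum j (Λ f) y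
      ≡⟨ cong₂ (λ s t → s ℤ.+ (ℤ.- Q) ℤ.* t)
           (trans (sum-linear (Q ℤ.* N) (λ _ → 1ℤ) (λ b → f (insertAt y j b)))
                  (cong (λ s → s ℤ.+ (Q ℤ.* N) ℤ.* L) (sum-const q 1ℤ)))
           (trans (lineSum-Λ j f y) (cong (λ t → Q ℤ.* L ℤ.+ t) (balls j y))) ⟩
    (Q ℤ.* 1ℤ ℤ.+ (Q ℤ.* N) ℤ.* L) ℤ.+ (ℤ.- Q) ℤ.* (Q ℤ.* L ℤ.+ (1ℤ ℤ.+ (+ n ℤ.- 1ℤ) ℤ.* L))
      ≡⟨ ring₂ Q (+ n ℤ.- 1ℤ) L ⟩
    0ℤ ∎
    where L = lineSum j f y

-- Extended perfect codes

module _ (C : Code (suc (suc n)) q) (ext : Extended1Perfect C) where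

  -- Deleting a coordinate other than `j` (1 if `j` is 0, and 0 otherwise) leaves two words in a
  -- common ball. Perfectness makes them equal, and coordinate `j` survives in them.
  separated : ∀ j x y → C x → C y → removeAt x j ≡ removeAt y j → x ≡ y
  separated zero (a ∷ b ∷ x) (a′ ∷ b ∷ x) Cx Cy refl
    with proj₂ (ext (suc zero) (a′ ∷ x)) (a ∷ x) (a′ ∷ x) (_ , Cx , refl) (_ , Cy , refl) (ball-head a a′ x) (inj₁ refl)
  ... | refl = refl
  separated (suc j) (a ∷ x@(_ ∷ _)) (a′ ∷ y@(_ ∷ _)) Cx Cy eq with ∷-injective eq
  ... | refl , eq′ = cong (a ∷_)
    (proj₂ (ext zero y) x y (_ , Cx , refl) (_ , Cy , refl) (ball-removeAt j x y eq′) (inj₁ refl))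

  -- Perfectness supplies the decision: covering the punctured `x` produces a codeword `c`, and by
  -- uniqueness and `separated` the word `x` is a codeword only if it equals `c`.
  member? : ∀ x → Dec (C x)
  member? x with ext zero (removeAt x zero)
  ... | (c′ , (c , Cc , refl) , c∈B) , unique with ≡-dec _≟_ c x
  ...   | yes refl = yes Cc
  ...   | no  c≢x  = no λ Cx → c≢x (separated zero c x Cc Cx
    (unique _ _ (c , Cc , refl) (x , Cx , refl) c∈B (inj₁ refl)))

  χ : Word (suc (suc n)) q → ℤ
  χ x with member? x
  ... | yes _ = 1ℤ
  ... | no  _ = 0ℤ

  χ-indicator : Indicator C χ
  proj₁ χ-indicator x Cx with member? x
  ... | yes _  = refl
  ... | no ¬Cx = contradiction Cx ¬Cx
  proj₂ χ-indicator x ¬Cx with member? x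
  ... | yes Cx = contradiction Cx ¬Cx
  ... | no  _  = refl

  -- By `separated`, no line contains two codewords.
  lineSum-indicator : ∀ j → Indicator (Puncture C j) (lineSum j χ)
  proj₁ (lineSum-indicator j) y (x , Cx , refl) =
    sum-single _ (lookup x j) (proj₁ χ-indicator _ (subst C (sym restore) Cx))
      (λ a a≢ → proj₂ χ-indicator _ (λ Ca → a≢ (trans (sym (insertAt-lookup (removeAt x j) j a))
        (cong (λ w → lookup w j) (separated j _ x Ca Cx (removeAt-insertAt (removeAt x j) j a))))))
    where
    restore : insertAt (removeAt x j) j (lookup x j) ≡ x
    restore = insertAt-removeAt x j
  proj₂ (lineSum-indicator j) y ¬Py =
    sum-zero _ (λ a → proj₂ χ-indicator _ (λ Ca → ¬Py (_ , Ca , removeAt-insertAt y j a)))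

  lineSum-balls : ∀ j → BallSumsOne (lineSum j χ)
  lineSum-balls j = perfect⇒ballSumsOne (ext j) (lineSum-indicator j)

  -- With the head deleted, `z` and the given codeword both lie in the ball around `b′ ∷ w`, so
  -- their tails agree. If the heads agree too, `z` is that codeword, which is at distance two; if
  -- not, deleting coordinate 1 puts two distinct punctured codewords in one ball.
  change-two-isolated : ∀ {a b a′ b′ w} → C (a ∷ b ∷ w) → a′ ≢ a → b′ ≢ b →
                        ∀ z → InBall1 z (a′ ∷ b′ ∷ w) → ¬ C z
  change-two-isolated {a} {b} {a′} {b′} {w} Cc a′≢a b′≢b (z₀ ∷ z₁ ∷ z) z∈B Cz
    with proj₂ (ext zero (b′ ∷ w)) (z₁ ∷ z) (b ∷ w) (_ , Cz , refl) (_ , Cc , refl) (ball-tail z∈B) (ball-head b b′ w)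
    where
    ball-tail : ∀ {m} {c d : Fin q} {u v : Word m q} → InBall1 (c ∷ u) (d ∷ v) → InBall1 u v
    ball-tail (inj₁ refl) = inj₁ refl
    ball-tail {c = c} {d} (inj₂ adj) with c ≟ d
    ... | yes _ = inj₂ adj
    ... | no  _ = inj₁ (sym (hamming≡0⇒≡ _ _ (ℕ.suc-injective adj)))
  ... | refl with z₀ ≟ a
  ...   | yes refl = far z∈B
    where
    far : ¬ InBall1 (z₀ ∷ b ∷ w) (a′ ∷ b′ ∷ w)
    far (inj₁ refl) = b′≢b refl
    far (inj₂ adj) with z₀ ≟ a′
    ... | yes refl = a′≢a refl
    ... | no  _    with b ≟ b′
    ...   | yes refl = b′≢b refl
    ...   | no  _    = contradiction adj λ ()
  ...   | no z₀≢a  = z₀≢a (∷-injectiveˡ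
    (proj₂ (ext (suc zero) (z₀ ∷ w)) _ _ (_ , Cz , refl) (_ , Cc , refl) (inj₁ refl) (ball-head a z₀ w)))

other : (a : Fin (suc (suc n))) → ∃ λ b → b ≢ a
other zero    = suc zero , λ ()
other (suc a) = zero , λ ()

length+alphabet∣power : ∀ {r} (C : Code (suc (suc n)) (suc (suc r))) → Extended1Perfect C →
                        suc (suc r) + n ℕ.∣ suc (suc r) ^ suc (suc n)
-- The all-zero word is an arbitrary choice that yields some codeword; changing its first two
-- letters gives the point `x` at distance two.
length+alphabet∣power {n} C ext with ext zero (replicate (suc n) zero)
... | (_ , (a ∷ b ∷ w , Cc , _) , _) , _ = ℤ.∣⇒∣ᵤ (extended-divisibility (χ C ext) (lineSum-balls C ext) x
      (isolated x (inj₁ refl)) (Λ-zero _ x isolated))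
  where
  x = proj₁ (other a) ∷ proj₁ (other b) ∷ w
  isolated : ∀ z → InBall1 z x → χ C ext z ≡ 0ℤ
  isolated z z∈B = proj₂ (χ-indicator C ext) z
    (change-two-isolated C ext Cc (proj₂ (other a)) (proj₂ (other b)) z z∈B)

-- Arithmetic

∣prime^⇒≡prime^ : ∀ {p d} e → Prime p → d ℕ.∣ p ^ e → ∃ λ a → d ≡ p ^ a
∣prime^⇒≡prime^ zero pp d∣1 = 0 , ℕ.∣1⇒≡1 d∣1
∣prime^⇒≡prime^ {p} {d} (suc e) pp d∣p^ with p ℕ.∣? d
... | yes (ℕ.divides d′ refl) with ∣prime^⇒≡prime^ e pp
        (ℕ.*-cancelˡ-∣ p ⦃ prime⇒nonZero pp ⦄ (subst (ℕ._∣ p ^ suc e) (ℕ.*-comm d′ p) d∣p^))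
...   | a , refl = suc a , ℕ.*-comm (p ^ a) p
∣prime^⇒≡prime^ {p} {d} (suc e) pp d∣p^ | no p∤d = ∣prime^⇒≡prime^ e pp (coprime-divisor coprime d∣p^)
  where
  coprime : Coprime d p
  coprime (i∣d , i∣p) with prime⇒irreducible pp i∣p
  ... | inj₁ i≡1  = i≡1
  ... | inj₂ refl = contradiction i∣d p∤d

-- With `P = suc u`, `q = suc r` and `M = suc (u * r)`, one has `M + P + q = P q + 2`. Taking
-- `d = p` forces `p = 2`; taking `d = 4` rules out that all three exponents exceed 1.
∣2 : ∀ {d} u r → d ℕ.∣ suc u → d ℕ.∣ suc r → d ℕ.∣ suc (u * r) → d ℕ.∣ 2
∣2 {d} u r d∣P d∣q d∣M = ℕ.∣m+n∣m⇒∣n (subst (d ℕ.∣_) (identity u r) (ℕ.∣m∣n⇒∣m+n (ℕ.∣m∣n⇒∣m+n d∣M d∣P) d∣q))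
  (ℕ.∣m⇒∣m*n (suc r) d∣P)
  where
  identity : ∀ u r → suc (u * r) + suc u + suc r ≡ suc u * suc r + 2
  identity = ℕRing.solve-∀

4∣2^ : ∀ e → 4 ℕ.∣ 2 ^ suc (suc e)
4∣2^ e = subst (4 ℕ.∣_) (ℕ.*-assoc 2 2 (2 ^ e)) (ℕ.m∣m*n (2 ^ e))

prime∣2⇒≡2 : ∀ {p} → Prime p → p ℕ.∣ 2 → p ≡ 2
prime∣2⇒≡2 pp p∣2 = ℕ.≤-antisym (ℕ.∣⇒≤ p∣2) (nonTrivial⇒n>1 _ ⦃ prime⇒nonTrivial pp ⦄)

-- With p ^ s = 1 + u and q = 1 + r, the two powers of p are q (1 + u) and q (1 + u r).
classify : ∀ {p} m s c u r → Prime p → 1 ≤ m → suc r ≡ p ^ m → suc u ≡ p ^ s → suc (u * r) ≡ p ^ c →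
           s ≡ 0 ⊎ (p ≡ 2 × (m ≡ 1 × 1 ≤ s ⊎ s ≡ 1))
classify m zero c u r pp _ q≡ P≡ M≡ = inj₁ refl
-- Exponent 0 gives `u r = 0`, so `P` or `q` would be 1 in spite of its positive exponent.
classify {p} (suc m) (suc s) zero u r pp _ q≡ P≡ M≡ with ℕ.m*n≡0⇒m≡0∨n≡0 u (ℕ.suc-injective M≡)
... | inj₁ refl = contradiction (ℕ.m^n≡1⇒n≡0∨m≡1 p (suc s) (sym P≡)) λ { (inj₂ refl) → ¬prime[1] pp }
... | inj₂ refl = contradiction (ℕ.m^n≡1⇒n≡0∨m≡1 p (suc m) (sym q≡)) λ { (inj₂ refl) → ¬prime[1] pp }
classify {p} (suc m) (suc s) (suc c) u r pp _ q≡ P≡ M≡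
  with prime∣2⇒≡2 pp (∣2 u r (p∣ s P≡) (p∣ m q≡) (p∣ c M≡))
  where
  p∣ : ∀ {x} e → x ≡ p ^ suc e → p ℕ.∣ x
  p∣ e refl = ℕ.m∣m*n (p ^ e)
... | refl = inj₂ (refl , exponents m s c q≡ P≡ M≡)
  where
  4∣ : ∀ {x} e → x ≡ 2 ^ suc (suc e) → 4 ℕ.∣ x
  4∣ e refl = 4∣2^ e
  exponents : ∀ m s c → suc r ≡ 2 ^ suc m → suc u ≡ 2 ^ suc s → suc (u * r) ≡ 2 ^ suc c →
              suc m ≡ 1 × 1 ≤ suc s ⊎ suc s ≡ 1
  exponents zero s c _ _ _ = inj₁ (refl , s≤s z≤n)
  exponents (suc m) zero c _ _ _ = inj₂ refl
  -- Here `u r = 1`, so `P = 2`, although 4 divides `P`.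
  exponents (suc m) (suc s) zero q≡ P≡ M≡
    with ℕ.m*n≡1⇒m≡1 u r (ℕ.suc-injective M≡)
  ... | refl = contradiction (4∣ s P≡) (ℕ.>⇒∤ (s≤s (s≤s (s≤s z≤n))))
  exponents (suc m) (suc s) (suc c) q≡ P≡ M≡ =
    contradiction (∣2 u r (4∣ s P≡) (4∣ m q≡) (4∣ c M≡)) (ℕ.>⇒∤ (s≤s (s≤s (s≤s z≤n))))

-- The code length is `suc (suc k)`, and the two powers are `N` and the ball size for the punctured
-- code. As `N` is at least `q`, it equals `q P` with `P = p ^ s`, and the length is
-- `2 + q (P − 1)`.
power-pair : ∀ {p} m a b k r → Prime p → 1 ≤ m → suc r ≡ p ^ m →
             suc r + k ≡ p ^ a → suc (suc k * r) ≡ p ^ b →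
             suc (suc k) ≡ 2
             ⊎ (p ≡ 2 × m ≡ 1 × ∃ λ t → 2 ≤ t × suc (suc k) ≡ 2 ^ t)
             ⊎ (p ≡ 2 × 1 ≤ m × suc (suc k) ≡ p ^ m + 2)
power-pair {p} m a b k r pp 1≤m q≡ N≡ B≡ with ℕ.m≤n⇒∃[o]m+o≡n m≤a
  where
  m≤a : m ≤ a
  m≤a = ℕ.≮⇒≥ λ a<m → ℕ.<⇒≱ (ℕ.^-monoʳ-< p (nonTrivial⇒n>1 p ⦃ prime⇒nonTrivial pp ⦄) a<m)
    (ℕ.≤-trans (ℕ.≤-reflexive (sym q≡)) (ℕ.≤-trans (ℕ.m≤m+n (suc r) k) (ℕ.≤-reflexive N≡)))
... | s , refl = finish (p ^ s) refl
  where
  open ≡-Reasoning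
  -- Abstracting `p ^ s` to `P` allows matching it as `suc u`.
  finish : ∀ P → P ≡ p ^ s → _
  finish zero    P≡ = contradiction (ℕ.m^n≡0⇒m≡0 p s (sym P≡)) λ { refl → ¬prime[0] pp }
  finish (suc u) P≡ = conclude (classify m s (proj₁ M) u r pp 1≤m q≡ P≡ (proj₂ M))
    where
    k≡ : k ≡ suc r * u
    k≡ = ℕ.+-cancelˡ-≡ (suc r) k (suc r * u) (begin
      suc r + k           ≡⟨ N≡ ⟩
      p ^ (m + s)         ≡⟨ ℕ.^-distribˡ-+-* p m s ⟩
      p ^ m * p ^ s       ≡⟨ cong₂ _*_ q≡ P≡ ⟨
      suc r * suc u       ≡⟨ ℕ.*-suc (suc r) u ⟩
      suc r + suc r * u   ∎)
    factor : ∀ u r → suc (suc (suc r * u) * r) ≡ suc (u * r) * suc r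
    factor = ℕRing.solve-∀
    M : ∃ λ c → suc (u * r) ≡ p ^ c
    M = ∣prime^⇒≡prime^ b pp (ℕ.divides (suc r) (begin
      p ^ b                        ≡⟨ B≡ ⟨
      suc (suc k * r)              ≡⟨ cong (λ k → suc (suc k * r)) k≡ ⟩
      suc (suc (suc r * u) * r)    ≡⟨ factor u r ⟩
      suc (u * r) * suc r          ≡⟨ ℕ.*-comm (suc (u * r)) (suc r) ⟩
      suc r * suc (u * r)          ∎))
    conclude : s ≡ 0 ⊎ (p ≡ 2 × (m ≡ 1 × 1 ≤ s ⊎ s ≡ 1)) → _
    conclude (inj₁ refl) = inj₁ (cong (λ k → suc (suc k)) (trans k≡
      (trans (cong (suc r *_) (ℕ.suc-injective P≡)) (ℕ.*-zeroʳ (suc r)))))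
    -- Since `q = 2`, the length is `2 + 2 u = 2 P`, whence `t = s + 1`.
    conclude (inj₂ (refl , inj₁ (refl , 1≤s))) = inj₂ (inj₁ (refl , refl , suc s , s≤s 1≤s , (begin
      suc (suc k)           ≡⟨ cong (λ k → suc (suc k)) k≡ ⟩
      2 + suc r * u         ≡⟨ cong (λ q → 2 + q * u) q≡ ⟩
      2 + 2 * u             ≡⟨ ℕ.*-suc 2 u ⟨
      2 * suc u             ≡⟨ cong (2 *_) P≡ ⟩
      2 ^ suc s             ∎)))
    -- Here `P = 2`, so `u = 1` and the length is `2 + q`.
    conclude (inj₂ (refl , inj₂ refl)) = inj₂ (inj₂ (refl , 1≤m , (begin
      suc (suc k)          ≡⟨ cong (λ k → suc (suc k)) k≡ ⟩
      suc (suc (suc r * u)) ≡⟨ cong (λ u → suc (suc (suc r * u))) (ℕ.suc-injective P≡) ⟩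
      2 + suc r * 1        ≡⟨ cong (λ x → 2 + x) (ℕ.*-identityʳ (suc r)) ⟩
      2 + suc r            ≡⟨ ℕ.+-comm 2 (suc r) ⟩
      suc r + 2            ≡⟨ cong (_+ 2) q≡ ⟩
      2 ^ m + 2            ∎)))

-- The alphabet size is a variable tied to `p ^ m` by an equation, so that it can be matched. Sizes
-- 0 and 1 are no positive powers of a prime, and two letters suffice to move off a codeword.
lengths : ∀ {p m} → Prime p → 1 ≤ m → q ≡ p ^ m → (C : Code (suc (suc n)) q) → Extended1Perfect C →
          suc (suc n) ≡ 2
          ⊎ (p ≡ 2 × m ≡ 1 × ∃ λ t → 2 ≤ t × suc (suc n) ≡ 2 ^ t)
          ⊎ (p ≡ 2 × 1 ≤ m × suc (suc n) ≡ p ^ m + 2)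
lengths {zero} {p = p} {m} pp 1≤m q≡ C ext =
  contradiction (ℕ.m^n≡0⇒m≡0 p m (sym q≡)) λ { refl → ¬prime[0] pp }
lengths {suc zero} {p = p} {m} pp 1≤m q≡ C ext with ℕ.m^n≡1⇒n≡0∨m≡1 p m (sym q≡)
... | inj₁ refl = contradiction 1≤m λ ()
... | inj₂ refl = contradiction pp ¬prime[1]
lengths {q@(suc (suc r))} {n} {p} {m} pp 1≤m q≡ C ext =
  power-pair m (proj₁ N) (proj₁ B) n (suc r) pp 1≤m q≡ (proj₂ N) (proj₂ B)
  where
  power : ∀ {d} e → d ℕ.∣ q ^ e → ∃ λ a → d ≡ p ^ a
  power {d} e d∣ = ∣prime^⇒≡prime^ (m * e) pp
    (subst (d ℕ.∣_) (trans (cong (_^ e) q≡) (ℕ.^-*-assoc p m e)) d∣)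
  N : ∃ λ a → q + n ≡ p ^ a
  N = power (suc (suc n)) (length+alphabet∣power C ext)
  -- Puncturing leaves length `suc n`, hence this ball size.
  B : ∃ λ b → suc (suc n * suc r) ≡ p ^ b
  B = power (suc n) (sphere-packing (lineSum zero (χ C ext)) (lineSum-balls C ext zero))

theorem2 : (p m n : ℕ) → Prime p → 1 ≤ m → 2 ≤ n →
    (C : Code n (p ^ m)) → Extended1Perfect C →
    n ≡ 2
    ⊎ (p ≡ 2 × m ≡ 1 × ∃ λ t → 2 ≤ t × n ≡ 2 ^ t)
    ⊎ (p ≡ 2 × 1 ≤ m × n ≡ p ^ m + 2)
theorem2 p m (suc (suc n)) pp 1≤m (s≤s (s≤s _)) C ext = lengths pp 1≤m refl C ext
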